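{- For every integer $n\ge 5$, the wheel $W_n=K_1\vee C_{n-1}$ of order $n$ satisfies $\operatorname{st}_{\gamma_{st}}(W_n)=1$.
   Context: All graphs are finite, simple and undirected. For a graph $G=(V,E)$, a set $D\subseteq V$ is a strong dominating set if every vertex $v\in V\setminus D$ is adjacent to some $u\in D$ with $\deg(v)\le\deg(u)$ (degrees taken in $G$). The strong domination number $\gamma_{st}(G)$ is the minimum size of a strong dominating set. For $S\subseteq V$, $G-S$ is the graph obtained by deleting the vertices of $S$. The stability of the strong domination number is $\operatorname{st}_{\gamma_{st}}(G)=\min\{|S| : S\subseteq V,\ \gamma_{st}(G-S)\ne\gamma_{st}(G)\}$. The join $G\vee H$ of disjoint graphs is obtained from $G\cup H$ by adding all edges between $V(G)$ and $V(H)$; $C_{m}$ is the cycle on $m$ vertices. -}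

module Defs where

open import Data.Fin using (Fin; zero; toℕ; splitAt)
open import Data.Fin.Properties using (_≟_; all?; any?)
open import Data.Fin.Subset using (Subset; _∈_; _∉_; _⊆_; _─_; ∣_∣; ⊤; ⊥; inside; outside; Nonempty)
open import Data.Fin.Subset.Properties
  using (_∈?_; _⊆?_; anySubset?; ∈⊤; ∉⊥; ∣⊥∣≡0; x∈p∧x∉q⇒x∈p─q; p─q⊆p)
open import Data.Nat using (ℕ; zero; suc; _+_; _∸_; _≤_; z≤n; s≤s)
import Data.Nat.Properties as ℕ
open import Data.Product using (∃; _×_; _,_; proj₁; proj₂)
open import Data.Sum using (_⊎_; inj₁; inj₂; swap; [_,_]′)
open import Data.Vec using (_∷_; _++_; lookup; tabulate; here; there)
open import Data.Vec.Properties using (lookup-splitAt; lookup⇒[]=; []=⇒lookup)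
open import Function using (_∘_)
open import Level using (0ℓ)
open import Relation.Binary using (Rel; Symmetric; Irreflexive)
import Relation.Binary as B
open import Relation.Binary.PropositionalEquality
  using (_≡_; _≢_; refl; sym; trans)
open import Relation.Nullary using (yes; no; ¬_; does; contradiction)
open import Relation.Nullary.Decidable using (_×-dec_; _⊎-dec_; _→-dec_; ¬?)
import Relation.Unary as U

IsMinimum : (ℕ → Set) → ℕ → Set
IsMinimum P m = P m × (∀ k → P k → m ≤ k)

minimum : {P : ℕ → Set} → U.Decidable P → ∀ k → P k → ∃ (IsMinimum P)
minimum P? zero    p = 0 , p , λ _ _ → z≤n
minimum P? (suc k) p with P? 0
... | yes p₀ = 0 , p₀ , λ _ _ → z≤n
... | no ¬p₀ with minimum (P? ∘ suc) k p
...   | m , pₘ , least = suc m , pₘ , λ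
  { zero    p₀ → contradiction p₀ ¬p₀
  ; (suc j) pⱼ → s≤s (least j pⱼ) }

-- A finite simple graph whose vertices are labelled by elements of Fin N.
-- Its vertex set V may be a proper subset of Fin N, so that deleting vertices
-- keeps the labels of the remaining ones.
record Graph (N : ℕ) : Set₁ where
  infix 4 _~_ _~?_
  field
    V       : Subset N
    _~_     : Rel (Fin N) 0ℓ
    _~?_    : B.Decidable _~_
    ~-sym   : Symmetric _~_
    ~-irr   : Irreflexive _≡_ _~_
    ~-in-V  : ∀ {u v} → u ~ v → u ∈ V

  neighbours : Fin N → Subset N
  neighbours v = tabulate λ u → does (v ~? u)

  deg : Fin N → ℕ
  deg v = ∣ neighbours v ∣

open Graph

infixl 5 _∖_

_∖_ : ∀ {N} → Graph N → Subset N → Graph N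
G ∖ S = record
  { V      = V G ─ S
  ; _~_    = λ u v → _~_ G u v × u ∉ S × v ∉ S
  ; _~?_   = λ u v → _~?_ G u v ×-dec ¬? (u ∈? S) ×-dec ¬? (v ∈? S)
  ; ~-sym  = λ (a , u∉ , v∉) → ~-sym G a , v∉ , u∉
  ; ~-irr  = λ eq (a , _) → ~-irr G eq a
  ; ~-in-V = λ (a , u∉ , _) → x∈p∧x∉q⇒x∈p─q (~-in-V G a) u∉
  }

IsStrongDominating : ∀ {N} → Graph N → Subset N → Set
IsStrongDominating G D =
  D ⊆ V G ×
  (∀ v → v ∈ V G → v ∉ D → ∃ λ u → u ∈ D × _~_ G v u × deg G v ≤ deg G u)

isStrongDominating? : ∀ {N} (G : Graph N) → U.Decidable (IsStrongDominating G)
isStrongDominating? G D =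
  (D ⊆? V G) ×-dec
  all? λ v → (v ∈? V G) →-dec (¬? (v ∈? D) →-dec
    any? λ u → (u ∈? D) ×-dec _~?_ G v u ×-dec (deg G v ℕ.≤? deg G u))

HasStrongDominatingSetOfSize : ∀ {N} → Graph N → ℕ → Set
HasStrongDominatingSetOfSize G k = ∃ λ D → IsStrongDominating G D × ∣ D ∣ ≡ k

γst-minimum : ∀ {N} (G : Graph N) → ∃ (IsMinimum (HasStrongDominatingSetOfSize G))
γst-minimum G =
  minimum (λ k → anySubset? λ D → isStrongDominating? G D ×-dec (∣ D ∣ ℕ.≟ k))
          ∣ V G ∣ (V G , ((λ x → x) , λ _ v∈V v∉V → contradiction v∈V v∉V) , refl)

γst : ∀ {N} → Graph N → ℕ
γst G = proj₁ (γst-minimum G)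

HasChangingSetOfSize : ∀ {N} → Graph N → ℕ → Set
HasChangingSetOfSize G k = ∃ λ S → S ⊆ V G × γst (G ∖ S) ≢ γst G × ∣ S ∣ ≡ k

∈─⇒∉ : ∀ {N} {x : Fin N} (p q : Subset N) → x ∈ p ─ q → x ∉ q
∈─⇒∉ (_ ∷ p) (_ ∷ q) (there x∈) (there x∈q) = ∈─⇒∉ p q x∈ x∈q

∣p∣≡0⇒x∉p : ∀ {N} {x : Fin N} (p : Subset N) → ∣ p ∣ ≡ 0 → x ∉ p
∣p∣≡0⇒x∉p (_ ∷ p) () here
∣p∣≡0⇒x∉p (outside ∷ p) eq (there x∈) = ∣p∣≡0⇒x∉p p eq x∈

γst-∖V : ∀ {N} (G : Graph N) → γst (G ∖ V G) ≡ 0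
γst-∖V {N} G = ℕ.n≤0⇒n≡0 (proj₂ (proj₂ (γst-minimum (G ∖ V G))) 0
  ( ⊥
  , ( (λ x∈⊥ → contradiction x∈⊥ ∉⊥)
    , λ _ v∈ _ → contradiction (p─q⊆p (V G) (V G) v∈) (∈─⇒∉ (V G) (V G) v∈))
  , ∣⊥∣≡0 N))

γst≢0 : ∀ {N} (G : Graph N) → Nonempty (V G) → γst G ≢ 0
γst≢0 G (v , v∈V) γ≡0 with γst-minimum G
... | m , (D , (_ , dom) , ∣D∣≡m) , _ =
  let empty = λ {x} → ∣p∣≡0⇒x∉p {x = x} D (trans ∣D∣≡m γ≡0)
      (_ , u∈D , _) = dom v v∈V empty
  in empty u∈D

-- Deleting every vertex of a nonempty graph changes γst, so the minimum exists;
-- on the graph without vertices the stability is undefined.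
st-minimum : ∀ {N} (G : Graph N) → Nonempty (V G) → ∃ (IsMinimum (HasChangingSetOfSize G))
st-minimum G ne =
  minimum (λ k → anySubset? λ S →
             (S ⊆? V G) ×-dec ¬? (γst (G ∖ S) ℕ.≟ γst G) ×-dec (∣ S ∣ ℕ.≟ k))
          ∣ V G ∣
          (V G , (λ x → x) , (λ eq → γst≢0 G ne (trans (sym eq) (γst-∖V G))) , refl)

st : ∀ {N} (G : Graph N) → Nonempty (V G) → ℕ
st G ne = proj₁ (st-minimum G ne)

complete : ∀ n → Graph n
complete n = record
  { V      = ⊤
  ; _~_    = _≢_
  ; _~?_   = λ u v → ¬? (u ≟ v)
  ; ~-sym  = λ u≢v v≡u → u≢v (sym v≡u)
  ; ~-irr  = λ u≡v u≢v → u≢v u≡v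
  ; ~-in-V = λ _ → ∈⊤
  }

CyclicSuc : ∀ {m} → Fin m → Fin m → Set
CyclicSuc {m} i j = toℕ j ≡ suc (toℕ i) ⊎ (suc (toℕ i) ≡ m × toℕ j ≡ 0)

cyclicSuc? : ∀ {m} → B.Decidable (CyclicSuc {m})
cyclicSuc? {m} i j =
  (toℕ j ℕ.≟ suc (toℕ i)) ⊎-dec ((suc (toℕ i) ℕ.≟ m) ×-dec (toℕ j ℕ.≟ 0))

-- The cycle C_m for m ≥ 3.  The conjunct i ≢ j only matters at m = 1, where it
-- removes the loop.
cycle : ∀ m → Graph m
cycle m = record
  { V      = ⊤
  ; _~_    = λ i j → i ≢ j × (CyclicSuc i j ⊎ CyclicSuc j i)
  ; _~?_   = λ i j → ¬? (i ≟ j) ×-dec (cyclicSuc? i j ⊎-dec cyclicSuc? j i)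
  ; ~-sym  = λ (i≢j , a) → (λ j≡i → i≢j (sym j≡i)) , swap a
  ; ~-irr  = λ i≡j (i≢j , _) → i≢j i≡j
  ; ~-in-V = λ _ → ∈⊤
  }

module _ {m k} (G : Graph m) (H : Graph k) where

  JoinAdj : Fin m ⊎ Fin k → Fin m ⊎ Fin k → Set
  JoinAdj (inj₁ u) (inj₁ v) = _~_ G u v
  JoinAdj (inj₁ u) (inj₂ v) = u ∈ V G × v ∈ V H
  JoinAdj (inj₂ u) (inj₁ v) = u ∈ V H × v ∈ V G
  JoinAdj (inj₂ u) (inj₂ v) = _~_ H u v

  joinAdj? : B.Decidable JoinAdj
  joinAdj? (inj₁ u) (inj₁ v) = _~?_ G u v
  joinAdj? (inj₁ u) (inj₂ v) = (u ∈? V G) ×-dec (v ∈? V H)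
  joinAdj? (inj₂ u) (inj₁ v) = (u ∈? V H) ×-dec (v ∈? V G)
  joinAdj? (inj₂ u) (inj₂ v) = _~?_ H u v

  joinAdj-sym : Symmetric JoinAdj
  joinAdj-sym {inj₁ _} {inj₁ _} a         = ~-sym G a
  joinAdj-sym {inj₁ _} {inj₂ _} (u∈ , v∈) = v∈ , u∈
  joinAdj-sym {inj₂ _} {inj₁ _} (u∈ , v∈) = v∈ , u∈
  joinAdj-sym {inj₂ _} {inj₂ _} a         = ~-sym H a

  joinAdj-irr : ∀ x → ¬ JoinAdj x x
  joinAdj-irr (inj₁ _) = ~-irr G refl
  joinAdj-irr (inj₂ _) = ~-irr H refl

  joinAdj-in-V : ∀ u y → JoinAdj (splitAt m u) y → u ∈ V G ++ V H
  joinAdj-in-V u y a = lookup⇒[]= u (V G ++ V H)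
    (trans (lookup-splitAt m (V G) (V H) u) (inside-side (splitAt m u) y a))
    where
    inside-side : ∀ x y → JoinAdj x y →
                  [ lookup (V G) , lookup (V H) ]′ x ≡ inside
    inside-side (inj₁ _) (inj₁ _) a        = []=⇒lookup (~-in-V G a)
    inside-side (inj₁ _) (inj₂ _) (u∈ , _) = []=⇒lookup u∈
    inside-side (inj₂ _) (inj₁ _) (u∈ , _) = []=⇒lookup u∈
    inside-side (inj₂ _) (inj₂ _) a        = []=⇒lookup (~-in-V H a)

  infixr 6 _∨_

  _∨_ : Graph (m + k)
  _∨_ = record
    { V      = V G ++ V H
    ; _~_    = λ u v → JoinAdj (splitAt m u) (splitAt m v)
    ; _~?_   = λ u v → joinAdj? (splitAt m u) (splitAt m v)
    ; ~-sym  = λ {u} {v} → joinAdj-sym {splitAt m u} {splitAt m v}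
    ; ~-irr  = λ { {u} refl → joinAdj-irr (splitAt m u) }
    ; ~-in-V = λ {u} {v} → joinAdj-in-V u (splitAt m v)
    }

wheel : ∀ n → Graph (1 + (n ∸ 1))
wheel n = complete 1 ∨ cycle (n ∸ 1)

wheel-nonempty : ∀ n → Nonempty (V (wheel n))
wheel-nonempty n = zero , here

{-# OPTIONS --safe #-}

-- The hub of a wheel is adjacent to every other vertex, so it has maximum degree
-- and {hub} is a strong dominating set: γst = 1.  Deleting the hub leaves a cycle
-- of length at least 4, where no vertex is adjacent to all the others: γst ≠ 1.
module Submission where

open import Defs
open import Data.Fin using (Fin; zero; suc)
open import Data.Fin.Properties using (_≟_)
open import Data.Fin.Subset using (Subset; _∈_; _∉_; _-_; ∣_∣; ⊤; ∁; ⁅_⁆)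
open import Data.Fin.Subset.Properties
  using (⊆-antisym; p⊆q⇒∣p∣≤∣q∣; p─q⊆p; x∈p∧x∉q⇒x∈p─q; x∈p∧x≢y⇒x∈p-y; x∈p⇒∣p-x∣<∣p∣;
         x∈⁅x⁆; x∈⁅y⁆⇒x≡y; x≢y⇒x∉⁅y⁆; ∣⁅x⁆∣≡1; x∉p⇒x∈∁p; x∈∁p⇒x∉p; ∣∁p∣≡n∸∣p∣; ∈⊤;
         ∣⊥∣≡0; Empty-unique; nonempty?)
open import Data.Nat using (ℕ; suc; _+_; _∸_; _≤_; z≤n; s≤s)
open import Data.Nat.Properties
  using (≤-reflexive; ≤-antisym; n≢0⇒n>0; n<1⇒n≡0; ≤-trans; module ≤-Reasoning)
open import Data.Product using (∃; _×_; _,_; proj₁; proj₂)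
open import Data.Sum using (inj₁; inj₂)
open import Data.Vec.Properties
  using (lookup∘tabulate; lookup⇒[]=; []=⇒lookup; tabulate-cong)
open import Function using (_∘_)
open import Function.Bundles using (_⇔_; mk⇔; Equivalence)
open import Function.Construct.Symmetry using (⇔-sym)
open import Relation.Binary.PropositionalEquality
  using (_≡_; _≢_; refl; sym; trans; cong; subst)
open import Relation.Nullary using (¬_; yes; no; contradiction)
open import Relation.Nullary.Decidable using (does-⇔; dec-true; dec-false)

open Graph

private
  variable
    N : ℕ

-- If `x` and `y` differed, removing `y` would leave a set of size 0 that still contains `x`.
∣p∣≡1⇒unique : {p : Subset N} {x y : Fin N} → ∣ p ∣ ≡ 1 → x ∈ p → y ∈ p → x ≡ y
∣p∣≡1⇒unique {p = p} {x} {y} ∣p∣≡1 x∈p y∈p with x ≟ y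
... | yes x≡y = x≡y
... | no  x≢y = contradiction (x∈p∧x≢y⇒x∈p-y x∈p x≢y)
  (∣p∣≡0⇒x∉p (p - y) (n<1⇒n≡0 (subst (suc ∣ p - y ∣ ≤_) ∣p∣≡1 (x∈p⇒∣p-x∣<∣p∣ y∈p))))

∣p∣≡1⇒nonempty : {p : Subset N} → ∣ p ∣ ≡ 1 → ∃ λ x → x ∈ p
∣p∣≡1⇒nonempty {N} {p} ∣p∣≡1 with nonempty? p
... | yes ne = ne
... | no ¬ne =
  contradiction (trans (sym ∣p∣≡1) (trans (cong ∣_∣ (Empty-unique ¬ne)) (∣⊥∣≡0 N))) λ ()

∣∁⁅x⁆∣≡n∸1 : (x : Fin N) → ∣ ∁ ⁅ x ⁆ ∣ ≡ N ∸ 1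
∣∁⁅x⁆∣≡n∸1 {N} x = trans (∣∁p∣≡n∸∣p∣ ⁅ x ⁆) (cong (N ∸_) (∣⁅x⁆∣≡1 x))

γst-least : (G : Graph N) {D : Subset N} → IsStrongDominating G D → γst G ≤ ∣ D ∣
γst-least G {D} sd = proj₂ (proj₂ (γst-minimum G)) ∣ D ∣ (D , sd , refl)

γst-attained : (G : Graph N) → HasStrongDominatingSetOfSize G (γst G)
γst-attained G = proj₁ (proj₂ (γst-minimum G))

infix 4 _≅_

-- Agreement on the same labels, with no relabelling. Propositional equality is too strict here:
-- adjacency in `G ∖ S` carries proofs of non-membership in `S` even when `S` is empty.
record _≅_ (G H : Graph N) : Set where
  field
    same-V : V G ≡ V H
    same-~ : ∀ u v → _~_ G u v ⇔ _~_ H u v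

open _≅_

≅-sym : {G H : Graph N} → G ≅ H → H ≅ G
≅-sym G≅H = record
  { same-V = sym (same-V G≅H)
  ; same-~ = λ u v → ⇔-sym (same-~ G≅H u v)
  }

-- The graphs may decide adjacency differently, but decisions of equivalent propositions have the
-- same Boolean value.
deg-cong : {G H : Graph N} → G ≅ H → ∀ v → deg G v ≡ deg H v
deg-cong {G = G} {H} G≅H v =
  cong ∣_∣ (tabulate-cong λ u → does-⇔ (same-~ G≅H v u) (_~?_ G v u) (_~?_ H v u))

IsStrongDominating-resp-≅ : {G H : Graph N} {D : Subset N} → G ≅ H →
                            IsStrongDominating G D → IsStrongDominating H D
IsStrongDominating-resp-≅ {G = G} {H} {D} G≅H (D⊆V , dom) =
  (λ x∈D → subst (_ ∈_) (same-V G≅H) (D⊆V x∈D)) , dom′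
  where
  dom′ : ∀ v → v ∈ V H → v ∉ D → ∃ λ u → u ∈ D × _~_ H v u × deg H v ≤ deg H u
  dom′ v v∈V v∉D with dom v (subst (v ∈_) (sym (same-V G≅H)) v∈V) v∉D
  ... | u , u∈D , v~u , deg≤ = u , u∈D , Equivalence.to (same-~ G≅H v u) v~u , (begin
    deg H v  ≡⟨ deg-cong G≅H v ⟨
    deg G v  ≤⟨ deg≤ ⟩
    deg G u  ≡⟨ deg-cong G≅H u ⟩
    deg H u  ∎)
    where open ≤-Reasoning

γst-mono-≅ : {G H : Graph N} → G ≅ H → γst H ≤ γst G
γst-mono-≅ {G = G} {H} G≅H with γst-attained G
... | D , sd , ∣D∣≡γ =
  ≤-trans (γst-least H (IsStrongDominating-resp-≅ G≅H sd)) (≤-reflexive ∣D∣≡γ)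

γst-cong : {G H : Graph N} → G ≅ H → γst G ≡ γst H
γst-cong G≅H = ≤-antisym (γst-mono-≅ (≅-sym G≅H)) (γst-mono-≅ G≅H)

∖-empty : (G : Graph N) {S : Subset N} → ∣ S ∣ ≡ 0 → (G ∖ S) ≅ G
∖-empty G {S} ∣S∣≡0 = record
  { same-V = ⊆-antisym (p─q⊆p (V G) S) (λ x∈V → x∈p∧x∉q⇒x∈p─q x∈V ∉S)
  ; same-~ = λ u v → mk⇔ proj₁ (λ u~v → u~v , ∉S , ∉S)
  }
  where
  ∉S : ∀ {x} → x ∉ S
  ∉S = ∣p∣≡0⇒x∉p S ∣S∣≡0

-- A changing set of size 0 would be empty, and deleting nothing preserves `γst`.
st≢0 : (G : Graph N) (ne : ∃ λ x → x ∈ V G) → st G ne ≢ 0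
st≢0 G ne st≡0 with proj₁ (proj₂ (st-minimum G ne))
... | S , _ , γ≢γ , ∣S∣≡st = γ≢γ (γst-cong (∖-empty G (trans ∣S∣≡st st≡0)))

~⇒∈neighbours : (G : Graph N) {u v : Fin N} → _~_ G u v → v ∈ neighbours G u
~⇒∈neighbours G {u} {v} u~v = lookup⇒[]= v (neighbours G u)
  (trans (lookup∘tabulate _ v) (dec-true (_~?_ G u v) u~v))

v∉neighbours : (G : Graph N) (v : Fin N) → v ∉ neighbours G v
v∉neighbours G v v∈ = contradiction
  (trans (sym ([]=⇒lookup v∈))
         (trans (lookup∘tabulate _ v) (dec-false (_~?_ G v v) (~-irr G refl))))
  λ ()

-- Here `v` ranges over all labels, so by `~-in-V` every label other than `u` is a vertex.
IsUniversal : Graph N → Fin N → Set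
IsUniversal G u = ∀ v → v ≢ u → _~_ G v u

-- No vertex is its own neighbour, so `N ∸ 1` bounds every degree, and `u` attains this bound.
universal-maxdeg : (G : Graph N) {u : Fin N} → IsUniversal G u → ∀ v → deg G v ≤ deg G u
universal-maxdeg {N} G {u} univ v = begin
  deg G v      ≤⟨ p⊆q⇒∣p∣≤∣q∣ (λ x∈ → x∉p⇒x∈∁p λ x∈⁅v⁆ →
                    v∉neighbours G v (subst (_∈ neighbours G v) (x∈⁅y⁆⇒x≡y v x∈⁅v⁆) x∈)) ⟩
  ∣ ∁ ⁅ v ⁆ ∣  ≡⟨ ∣∁⁅x⁆∣≡n∸1 v ⟩
  N ∸ 1        ≡⟨ ∣∁⁅x⁆∣≡n∸1 u ⟨
  ∣ ∁ ⁅ u ⁆ ∣  ≤⟨ p⊆q⇒∣p∣≤∣q∣ (λ {x} x∈ → ~⇒∈neighbours G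
                    (~-sym G (univ x λ { refl → x∈∁p⇒x∉p x∈ (x∈⁅x⁆ u) }))) ⟩
  deg G u      ∎
  where open ≤-Reasoning

universal⇒γst≡1 : (G : Graph N) {u : Fin N} → u ∈ V G → IsUniversal G u → γst G ≡ 1
universal⇒γst≡1 G {u} u∈V univ = ≤-antisym
  (≤-trans (γst-least G sd) (≤-reflexive (∣⁅x⁆∣≡1 u)))
  (n≢0⇒n>0 (γst≢0 G (u , u∈V)))
  where
  sd : IsStrongDominating G ⁅ u ⁆
  sd = (λ x∈ → subst (_∈ V G) (sym (x∈⁅y⁆⇒x≡y u x∈)) u∈V)
     , λ v _ v∉ → u , x∈⁅x⁆ u
                , univ v (λ { refl → v∉ (x∈⁅x⁆ u) }) , universal-maxdeg G univ v

-- A strong dominating set of size 1 is some `⁅ u ⁆`; the vertex `v` far from `u` lies outside it,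
-- and its dominator `w` can only be `u`.
nonadjacent⇒γst≢1 : (G : Graph N) →
  (∀ u → u ∈ V G → ∃ λ v → v ∈ V G × v ≢ u × ¬ _~_ G v u) → γst G ≢ 1
nonadjacent⇒γst≢1 G far γ≡1 with γst-attained G
... | D , (D⊆V , dom) , ∣D∣≡γ
  with ∣D∣≡1 ← trans ∣D∣≡γ γ≡1
  with u , u∈D ← ∣p∣≡1⇒nonempty {p = D} ∣D∣≡1
  with v , v∈V , v≢u , v≁u ← far u (D⊆V u∈D)
  with w , w∈D , v~w , _ ← dom v v∈V (λ v∈D → v≢u (∣p∣≡1⇒unique ∣D∣≡1 v∈D u∈D))
  = v≁u (subst (_~_ G v) (∣p∣≡1⇒unique ∣D∣≡1 w∈D u∈D) v~w)

-- Length at least 4 is essential: in a triangle all vertices are adjacent. Vertices 0 and 1 are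
-- paired with 2 and 3, vertex 2 with 0, and all later ones with 1, whose only neighbours are 0 and
-- 2.
cycle-nonadjacent : ∀ {k} (i : Fin (4 + k)) → ∃ λ j → j ≢ i × ¬ _~_ (cycle (4 + k)) j i
cycle-nonadjacent zero = suc (suc zero) , (λ ()) , λ
  { (_ , inj₁ (inj₁ ())) ; (_ , inj₁ (inj₂ (() , _)))
  ; (_ , inj₂ (inj₁ ())) ; (_ , inj₂ (inj₂ (() , _))) }
cycle-nonadjacent (suc zero) = suc (suc (suc zero)) , (λ ()) , λ
  { (_ , inj₁ (inj₁ ())) ; (_ , inj₁ (inj₂ (_ , ())))
  ; (_ , inj₂ (inj₁ ())) ; (_ , inj₂ (inj₂ (() , _))) }
cycle-nonadjacent (suc (suc zero)) = zero , (λ ()) , λ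
  { (_ , inj₁ (inj₁ ())) ; (_ , inj₁ (inj₂ (() , _)))
  ; (_ , inj₂ (inj₁ ())) ; (_ , inj₂ (inj₂ (() , _))) }
cycle-nonadjacent (suc (suc (suc i))) = suc zero , (λ ()) , λ
  { (_ , inj₁ (inj₁ ())) ; (_ , inj₁ (inj₂ (() , _)))
  ; (_ , inj₂ (inj₁ ())) ; (_ , inj₂ (inj₂ (_ , ()))) }

-- The hub comes first in the join, so it has label `zero` and the rim vertices are the labels
-- `suc i`.
hub-universal : ∀ n → IsUniversal (wheel n) zero
hub-universal n zero    0≢0 = contradiction refl 0≢0
hub-universal n (suc i) _   = ∈⊤ , ∈⊤

γst-wheel∖hub≢1 : ∀ k → γst (wheel (5 + k) ∖ ⁅ zero ⁆) ≢ 1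
γst-wheel∖hub≢1 k = nonadjacent⇒γst≢1 (wheel (5 + k) ∖ ⁅ zero ⁆) far
  where
  rim = wheel (5 + k) ∖ ⁅ zero ⁆

  far : ∀ u → u ∈ V rim → ∃ λ v → v ∈ V rim × v ≢ u × ¬ _~_ rim v u
  far zero u∈ = contradiction (x∈⁅x⁆ zero) (∈─⇒∉ ⊤ ⁅ zero ⁆ u∈)
  far (suc i) _ with cycle-nonadjacent i
  ... | j , j≢i , j≁i =
    -- Between rim labels, join adjacency reduces to cycle adjacency; `proj₁` drops the conditions
    -- added by the deletion.
    suc j , x∈p∧x∉q⇒x∈p─q {p = ⊤} ∈⊤ (x≢y⇒x∉⁅y⁆ {y = zero} λ ())
          , (λ { refl → j≢i refl }) , j≁i ∘ proj₁

proposition2p4 : (n : ℕ) → 5 ≤ n → st (wheel n) (wheel-nonempty n) ≡ 1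
proposition2p4 n@(suc (suc (suc (suc (suc k))))) (s≤s (s≤s (s≤s (s≤s (s≤s z≤n))))) =
  -- The hub alone is a changing set of size 1, which gives the upper bound; `st≢0` gives the lower
  -- one.
  ≤-antisym (least 1 (⁅ zero ⁆ , (λ _ → ∈⊤) , changes , ∣⁅x⁆∣≡1 (zero {n ∸ 1})))
            (n≢0⇒n>0 (st≢0 (wheel n) (wheel-nonempty n)))
  where
  least = proj₂ (proj₂ (st-minimum (wheel n) (wheel-nonempty n)))

  changes : γst (wheel n ∖ ⁅ zero ⁆) ≢ γst (wheel n)
  changes γ≡γ = γst-wheel∖hub≢1 k
    (trans γ≡γ (universal⇒γst≡1 (wheel n) ∈⊤ (hub-universal n)))
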